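{- Let $m,\delta\in\mathbb N=\{1,2,\ldots\}$, and consider additive wall subtraction with subtraction set $S(m,\delta)=\{m,\;m+\delta,\;2m+\delta\}$. Let $d$ be the residue of $\delta$ modulo $2m$ with $0\le d<2m$. Then the period length of the outcome sequence $(o_{\rm wall}(x))_{x\ge 0}$ is $$p(m,\delta)=\begin{cases}3m+2\delta-d, & \text{if } 0\le d\le m,\\[2pt] \dfrac{m(m+2\delta+d)}{\gcd(m,d)}, & \text{otherwise (i.e. if } m<d<2m).\end{cases}$$
   Context: Wall subtraction with finite subtraction set $S\subset\mathbb N$ is the classical subtraction game: a two-player impartial game under normal play (a player who cannot move loses) whose positions are the non-negative integers, and where from position $x\ge 0$ the options are $x-s$ for those $s\in S$ with $x-s\ge 0$ (moves to negative integers are forbidden). The outcome $o_{\rm wall}(x)\in\{\mathcal P,\mathcal N\}$ of position $x$ is $\mathcal P$ if the previous player (the one not to move) wins under optimal play, and $\mathcal N$ if the current player wins. Equivalently, $o_{\rm wall}(x)=\mathcal P$ if and only if no option of $x$ has outcome $\mathcal P$. The outcome sequence of a finite subtraction set is eventually periodic; its period length is the least integer $p\ge1$ such that $o_{\rm wall}(x+p)=o_{\rm wall}(x)$ for all sufficiently large $x$. -}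

module Defs where

open import Data.Bool.Base using (if_then_else_)
open import Data.List.Base using (List; []; _∷_; map; filter)
open import Data.List.Membership.Propositional using (_∈_)
open import Data.List.Membership.Propositional.Properties using (∈-map⁻; ∈-filter⁻)
open import Data.List.Relation.Unary.All as All using (All; []; _∷_)
open import Data.List.Relation.Unary.Any as Any using (Any; here; there)
open import Data.Nat.Base
open import Data.Nat.DivMod using (_/_; _%_)
open import Data.Nat.GCD using (gcd; gcd[m,n]≢0)
open import Data.Nat.Induction using (<-wellFounded)
open import Data.Nat.Properties using (_≤?_; ∸-monoʳ-<; m*n≢0; m≤n⇒m≤n+o)
open import Data.Product.Base using (∃-syntax; _×_; _,_)
open import Data.Sum.Base using (_⊎_; inj₁; inj₂)
open import Function.Bundles using (_⇔_; mk⇔)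
open import Induction.WellFounded using (Acc; acc)
open import Relation.Binary.PropositionalEquality using (_≡_; refl)
open import Relation.Nullary.Decidable using (⌊_⌋)
open import Relation.Nullary.Negation using (¬_; contradiction)

record SubtractionSet : Set where
  field
    elements : List ℕ
    positive : All (_> 0) elements

module WallSubtraction (S : SubtractionSet) where
  open SubtractionSet S

  options : ℕ → List ℕ
  options x = map (x ∸_) (filter (_≤? x) elements)

  options-< : ∀ {x y} → y ∈ options x → y < x
  options-< {x} y∈ with ∈-map⁻ (x ∸_) y∈
  ... | s , s∈ , refl with ∈-filter⁻ (_≤? x) {xs = elements} s∈
  ... | s∈S , s≤x = ∸-monoʳ-< (All.lookup positive s∈S) s≤x

  -- Winning strategies under normal play; a terminal position has no options,
  -- so it is vacuously a win for the previous player.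
  data PreviousWins (x : ℕ) : Set
  data CurrentWins  (x : ℕ) : Set

  data PreviousWins x where
    reply : All CurrentWins (options x) → PreviousWins x

  data CurrentWins x where
    move : Any PreviousWins (options x) → CurrentWins x

  private
    allOrAny : ∀ {ys} → All (λ y → PreviousWins y ⊎ CurrentWins y) ys →
               All CurrentWins ys ⊎ Any PreviousWins ys
    allOrAny []            = inj₁ []
    allOrAny (inj₁ p ∷ _)  = inj₂ (here p)
    allOrAny (inj₂ c ∷ ws) with allOrAny ws
    ... | inj₁ cs = inj₁ (c ∷ cs)
    ... | inj₂ p  = inj₂ (there p)

    determinedAcc : ∀ {x} → Acc _<_ x → PreviousWins x ⊎ CurrentWins x
    determinedAcc (acc rs) with allOrAny (All.tabulate (λ y∈ → determinedAcc (rs (options-< y∈))))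
    ... | inj₁ cs = inj₁ (reply cs)
    ... | inj₂ p  = inj₂ (move p)

  determined : ∀ x → PreviousWins x ⊎ CurrentWins x
  determined x = determinedAcc (<-wellFounded x)

  mutual
    exclusive : ∀ {x} → PreviousWins x → ¬ CurrentWins x
    exclusive (reply cs) (move p) = exclusiveAny cs p

    private
      exclusiveAny : ∀ {ys} → All CurrentWins ys → ¬ Any PreviousWins ys
      exclusiveAny (c ∷ _)  (here p)   = exclusive p c
      exclusiveAny (_ ∷ cs) (there ps) = exclusiveAny cs ps

  data Outcome : Set where
    𝒫 𝒩 : Outcome

  outcome : ℕ → Outcome
  outcome x with determined x
  ... | inj₁ _ = 𝒫
  ... | inj₂ _ = 𝒩

  outcome-𝒫⇔PreviousWins : ∀ x → outcome x ≡ 𝒫 ⇔ PreviousWins x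
  outcome-𝒫⇔PreviousWins x with determined x
  ... | inj₁ p = mk⇔ (λ _ → p) (λ _ → refl)
  ... | inj₂ c = mk⇔ (λ ()) (λ p → contradiction c (exclusive p))

  outcome-𝒩⇔CurrentWins : ∀ x → outcome x ≡ 𝒩 ⇔ CurrentWins x
  outcome-𝒩⇔CurrentWins x with determined x
  ... | inj₁ p = mk⇔ (λ ()) (λ c → contradiction c (exclusive p))
  ... | inj₂ c = mk⇔ (λ _ → c) (λ _ → refl)

module _ {a} {A : Set a} where

  IsEventualPeriod : (ℕ → A) → ℕ → Set a
  IsEventualPeriod f p = ∃[ x₀ ] (∀ x → x ≥ x₀ → f (x + p) ≡ f x)

  IsPeriodLength : (ℕ → A) → ℕ → Set a
  IsPeriodLength f p =
    p ≥ 1 × IsEventualPeriod f p × (∀ q → q ≥ 1 → IsEventualPeriod f q → p ≤ q)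

module _ (m δ : ℕ) .{{_ : NonZero m}} where

  additiveSet : SubtractionSet
  additiveSet = record
    { elements = m ∷ m + δ ∷ 2 * m + δ ∷ []
    ; positive = m>0 ∷ m≤n⇒m≤n+o δ m>0 ∷ m≤n⇒m≤n+o δ (m≤n⇒m≤n+o (m + 0) m>0) ∷ []
    }
    where
    m>0 : m > 0
    m>0 = >-nonZero⁻¹ m

  -- d ≤ δ, so the truncated subtraction is exact; gcd m d divides m, so the
  -- division is exact too.
  additivePeriod : ℕ
  additivePeriod =
    if ⌊ d ≤? m ⌋
    then 3 * m + 2 * δ ∸ d
    else (m * (m + 2 * δ + d) / gcd m d) {{gcd≢0}}
    where
    d : ℕ
    d = (δ % (2 * m)) {{m*n≢0 2 m}}

    .gcd≢0 : NonZero (gcd m d)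
    gcd≢0 = ≢-nonZero (gcd[m,n]≢0 m d (inj₁ (≢-nonZero⁻¹ m)))

{-# OPTIONS --safe #-}
module Submission where

-- Put b = m + δ and let φ w = w + m ⌊w / m⌋. With h and r chosen so that b = 2hm + r
-- (when d = m + r > m) or b + m = 2hm + d and r = 0 (when d ≤ m), the 𝒫-positions are
--   q k v = (b + 2hm) k + φ (r k + v),   k ≥ 0, 0 ≤ v < c = hm + r.
-- Along a residue class modulo m, x ↦ x + m takes q k v to q k v + m, then to q k (v + m),
-- and at the end of the block through the translates by b and by b + m of a position
-- of the same block to q (k + 1) u, because q k (u + c) + b = q (k + 1) u. Thus every
-- position is some q k v or has one as an option; that no option of a q k v is a
-- q k′ v′ follows from monotonicity and from φ never taking values that differ by m.
--
-- If m ∣ r n then x ↦ x + (b + 2hm + 2r) n takes block k to block k + n. Conversely,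
-- the block starts q k 0 are the only 𝒫-positions with no 𝒫-position among the b positions
-- below them, so any period is q l 0 for some l; that the first m positions of block l are shifted
-- without a gap then forces m ∣ r l. The least such l is 1 for r = 0 and m / gcd(m , r)
-- otherwise.

open import Defs
open import Data.List.Membership.Propositional using (_∈_; lose)
open import Data.List.Membership.Propositional.Properties using (∈-map⁺; ∈-map⁻; ∈-filter⁺; ∈-filter⁻)
open import Data.List.Relation.Unary.All as All using ()
open import Data.List.Relation.Unary.Any using (here; there)
open import Data.Nat.Base
open import Data.Nat.Divisibility using (_∣_; divides; _∣0; ∣⇒≤; ∣m∣n⇒∣m+n; ∣m+n∣m⇒∣n; n∣m*n;
  m%n≡0⇒n∣m)
open import Data.Nat.DivMod
open import Data.Nat.GCD using (gcd; gcd[m,n]≢0; gcd[m,n]∣m; gcd[m,n]∣n; gcd-greatest;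
  c*gcd[m,n]≡gcd[cm,cn]; m/gcd[m,n]≢0)
open import Data.Nat.Induction using (<-rec)
open import Data.Nat.Properties
open import Data.Nat.Tactic.RingSolver using (solve-∀)
open import Data.Product.Base using (∃-syntax; _×_; _,_; proj₁; proj₂)
open import Data.Sum.Base using (_⊎_; inj₁; inj₂)
open import Function.Base using (_∘_)
open import Function.Bundles using (Equivalence)
open import Relation.Binary.Definitions using (tri<; tri≈; tri>)
open import Relation.Binary.PropositionalEquality
open import Relation.Nullary.Decidable using (yes; no)
open import Relation.Nullary.Negation using (¬_; contradiction)
open import Algebra.Properties.CommutativeSemigroup +-commutativeSemigroup
  using (xy∙z≈xz∙y; x∙yz≈y∙xz; x∙yz≈y∙zx)

-- Kernels of subtraction games and outcomes

module _ (S : SubtractionSet) where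
  open SubtractionSet S
  open WallSubtraction S

  option⁺ : ∀ {x y s} → s ∈ elements → x ≡ y + s → y ∈ options x
  option⁺ {y = y} {s} s∈ refl =
    subst (_∈ options (y + s)) (m+n∸n≡m y s)
      (∈-map⁺ (y + s ∸_) (∈-filter⁺ (_≤? y + s) s∈ (m≤n+m s y)))

  option⁻ : ∀ {x y} → y ∈ options x → ∃[ s ] s ∈ elements × x ≡ y + s
  option⁻ {x} y∈ with ∈-map⁻ (x ∸_) y∈
  ... | s , s∈ , refl with ∈-filter⁻ (_≤? x) {xs = elements} s∈
  ... | s∈S , s≤x = s , s∈S , sym (m∸n+n≡m s≤x)

  module Kernel (Q : ℕ → Set)
    (independent : ∀ {y s} → s ∈ elements → Q y → ¬ Q (y + s))
    (absorbing : ∀ x → Q x ⊎ ∃[ y ] ∃[ s ] s ∈ elements × x ≡ y + s × Q y)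
    where

    private
      -- Strong induction on `x`, both halves together: from a position in `Q` independence sends
      -- every move out of `Q`, and from any other position absorption supplies a move into `Q`.
      wins : ∀ x → (Q x → PreviousWins x) × (¬ Q x → CurrentWins x)
      wins = <-rec _ step
        where
        step : ∀ x → (∀ {y} → y < x → (Q y → PreviousWins y) × (¬ Q y → CurrentWins y)) →
               (Q x → PreviousWins x) × (¬ Q x → CurrentWins x)
        step x rec = (λ qx → reply (All.tabulate (toCurrent qx))) , toPrevious
          where
          toCurrent : Q x → ∀ {y} → y ∈ options x → CurrentWins y
          toCurrent qx y∈ with option⁻ y∈
          ... | s , s∈ , refl = proj₂ (rec (options-< y∈)) (λ qy → independent s∈ qy qx)

          toPrevious : ¬ Q x → CurrentWins x
          toPrevious ¬qx with absorbing x
          ... | inj₁ qx = contradiction qx ¬qx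
          ... | inj₂ (y , s , s∈ , x≡ , qy) = move (lose y∈ (proj₁ (rec (options-< y∈)) qy))
            where y∈ = option⁺ s∈ x≡

    outcome-𝒫 : ∀ {x} → Q x → outcome x ≡ 𝒫
    outcome-𝒫 {x} = Equivalence.from (outcome-𝒫⇔PreviousWins x) ∘ proj₁ (wins x)

    outcome-𝒩 : ∀ {x} → ¬ Q x → outcome x ≡ 𝒩
    outcome-𝒩 {x} = Equivalence.from (outcome-𝒩⇔CurrentWins x) ∘ proj₂ (wins x)

    -- Absorption either finds `x` in `Q` or finds an option of `x` in `Q`; in the second case
    -- independence excludes `x`.
    kernel? : ∀ x → Q x ⊎ ¬ Q x
    kernel? x with absorbing x
    ... | inj₁ qx = inj₁ qx
    ... | inj₂ (y , s , s∈ , refl , qy) = inj₂ (independent s∈ qy)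

    𝒫-kernel : ∀ {x} → outcome x ≡ 𝒫 → Q x
    𝒫-kernel {x} o≡𝒫 with kernel? x
    ... | inj₁ qx = qx
    ... | inj₂ ¬qx with () ← trans (sym o≡𝒫) (outcome-𝒩 ¬qx)

    outcome-cong : ∀ {x y} → (Q x → Q y) → (Q y → Q x) → outcome x ≡ outcome y
    outcome-cong {x} {y} f g with kernel? x
    ... | inj₁ qx = trans (outcome-𝒫 qx) (sym (outcome-𝒫 (f qx)))
    ... | inj₂ ¬qx = trans (outcome-𝒩 ¬qx) (sym (outcome-𝒩 (¬qx ∘ g)))

    kernel-cong : ∀ {x y} → outcome x ≡ outcome y → Q x → Q y
    kernel-cong eq qx = 𝒫-kernel (trans (sym eq) (outcome-𝒫 qx))

-- Eventual periods of a purely periodic sequence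

module _ {a} {A : Set a} {f : ℕ → A} {p : ℕ} (periodic : ∀ x → f (x + p) ≡ f x) where

  periodic-* : ∀ j x → f (x + j * p) ≡ f x
  periodic-* zero    x = cong f (+-identityʳ x)
  periodic-* (suc j) x = begin
    f (x + (p + j * p)) ≡⟨ cong f (+-assoc x p (j * p)) ⟨
    f (x + p + j * p)   ≡⟨ periodic-* j (x + p) ⟩
    f (x + p)           ≡⟨ periodic x ⟩
    f x                 ∎
    where open ≡-Reasoning

  -- Translation by `x₀ * p ≥ x₀` preserves `f` and carries every argument past the threshold `x₀`.
  eventual⇒pure : .{{_ : NonZero p}} → ∀ {q} → IsEventualPeriod f q → ∀ x → f (x + q) ≡ f x
  eventual⇒pure {q} (x₀ , per) x = begin
    f (x + q)          ≡⟨ periodic-* x₀ (x + q) ⟨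
    f (x + q + x₀ * p) ≡⟨ cong f (xy∙z≈xz∙y x q (x₀ * p)) ⟩
    f (x + x₀ * p + q) ≡⟨ per (x + x₀ * p) (≤-trans (m≤m*n x₀ p) (m≤n+m _ x)) ⟩
    f (x + x₀ * p)     ≡⟨ periodic-* x₀ x ⟩
    f x                ∎
    where open ≡-Reasoning

-- The stretching map φ

module Stretch (m : ℕ) .{{_ : NonZero m}} where

  -- φ maps the block [im, im + m) onto [2im, 2im + m).
  φ : ℕ → ℕ
  φ w = w + w / m * m

  quotient-+ : ∀ w e → (w + e * m) / m ≡ w / m + e
  quotient-+ w e = trans (+-distrib-/-∣ʳ w (divides e refl)) (cong (w / m +_) (m*n/n≡m e m))

  φ-+* : ∀ w e → φ (w + e * m) ≡ φ w + 2 * (e * m)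
  φ-+* w e rewrite quotient-+ w e = lemma w e m (w / m)
    where
    lemma : ∀ w e m t → w + e * m + (t + e) * m ≡ w + t * m + 2 * (e * m)
    lemma = solve-∀

  φ-small : ∀ {w} → w < m → φ w ≡ w
  φ-small {w} w<m rewrite m<n⇒m/n≡0 w<m = +-identityʳ w

  φ-mono-≤ : ∀ {v w} → v ≤ w → φ v ≤ φ w
  φ-mono-≤ v≤w = +-mono-≤ v≤w (*-monoˡ-≤ m (/-monoˡ-≤ m v≤w))

  φ-mono-< : ∀ {v w} → v < w → φ v < φ w
  φ-mono-< v<w = +-mono-<-≤ v<w (*-monoˡ-≤ m (/-monoˡ-≤ m (<⇒≤ v<w)))

  φ-expand : ∀ w j → φ w + j ≤ φ (w + j)
  φ-expand w j = begin
    w + w / m * m + j       ≡⟨ xy∙z≈xz∙y w _ j ⟩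
    w + j + w / m * m       ≤⟨ +-monoʳ-≤ (w + j) (*-monoˡ-≤ m (/-monoˡ-≤ m (m≤m+n w j))) ⟩
    w + j + (w + j) / m * m ∎
    where
    open ≤-Reasoning

  φ-suc : ∀ w → φ (suc w) ≤ φ w + suc m
  φ-suc w = begin
    suc w + suc w / m * m             ≤⟨ +-monoʳ-≤ (suc w) (*-monoˡ-≤ m (/-monoˡ-≤ m suc-w≤)) ⟩
    suc w + (w + 1 * m) / m * m       ≡⟨ cong (λ t → suc w + t * m) (quotient-+ w 1) ⟩
    suc w + (w / m + 1) * m           ≡⟨ lemma w (w / m) m ⟩
    w + w / m * m + suc m             ∎
    where
    open ≤-Reasoning
    suc-w≤ : suc w ≤ w + 1 * m
    suc-w≤ = subst₂ _≤_ (+-comm w 1) (cong (w +_) (sym (*-identityˡ m)))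
               (+-monoʳ-≤ w (>-nonZero⁻¹ m))
    lemma : ∀ w t m → suc w + (t + 1) * m ≡ w + t * m + suc m
    lemma = solve-∀

  φ-suc-≡ : ∀ {w} → suc w / m ≡ w / m → φ (suc w) ≡ suc (φ w)
  φ-suc-≡ {w} eq = cong (λ t → suc w + t * m) eq

  -- If `v` and `w` have the same quotient by `m`, equality would give `w = v + m`, whose quotient
  -- is larger by one. If the quotient of `w` is larger, it alone contributes at least `m`, and
  -- `v < w` makes the difference exceed `m`.
  φ-≢+m : ∀ v w → φ w ≢ φ v + m
  φ-≢+m v w eq with m≤n⇒m<n∨m≡n (/-monoˡ-≤ m v≤w)
    where
    v≤w : v ≤ w
    v≤w = ≮⇒≥ λ w<v → <⇒≱ (φ-mono-< w<v) (subst (φ v ≤_) (sym eq) (m≤m+n (φ v) m))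
  ... | inj₂ v/m≡w/m = m≢1+n+m (v / m) (trans v/m≡w/m (trans (cong (_/ m) w≡v+m)
                          (trans (quotient-+ v 1) (+-comm (v / m) 1))))
    where
    w≡v+m : w ≡ v + 1 * m
    w≡v+m = +-cancelʳ-≡ (w / m * m) w (v + 1 * m) (begin
      w + w / m * m       ≡⟨ eq ⟩
      v + v / m * m + m   ≡⟨ xy∙z≈xz∙y v _ m ⟩
      v + m + v / m * m   ≡⟨ cong₂ (λ s t → v + s + t * m) (sym (*-identityˡ m)) v/m≡w/m ⟩
      v + 1 * m + w / m * m ∎)
      where open ≡-Reasoning
  ... | inj₁ v/m<w/m = <⇒≢ (begin-strict
      v + v / m * m + m     ≡⟨ lemma v (v / m) m ⟩
      v + suc (v / m) * m   <⟨ +-mono-<-≤ v<w (*-monoˡ-≤ m v/m<w/m) ⟩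
      w + w / m * m         ∎) (sym eq)
    where
    open ≤-Reasoning
    v<w : v < w
    v<w = ≰⇒> λ w≤v → <⇒≱ v/m<w/m (/-monoˡ-≤ m w≤v)
    lemma : ∀ v t m → v + t * m + m ≡ v + suc t * m
    lemma = solve-∀

  -- A step of length at most `m` raises the quotient by at most one.
  φ-+ : ∀ w {j} → j ≤ m → φ (w + j) ≡ φ w + j ⊎ φ (w + j) ≡ φ w + (j + m)
  φ-+ w {j} j≤m with m≤n⇒m<n∨m≡n (/-monoˡ-≤ m (m≤m+n w j))
  ... | inj₂ same = inj₁ (trans (cong (λ t → w + j + t * m) (sym same)) (xy∙z≈xz∙y w j _))
  ... | inj₁ lower = inj₂ (trans (cong (λ t → w + j + t * m) (≤-antisym upper lower)) (lemma w j m (w / m)))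
    where
    upper : (w + j) / m ≤ suc (w / m)
    upper = begin
      (w + j) / m     ≤⟨ /-monoˡ-≤ m (+-monoʳ-≤ w (≤-trans j≤m (≤-reflexive (sym (*-identityˡ m))))) ⟩
      (w + 1 * m) / m ≡⟨ quotient-+ w 1 ⟩
      w / m + 1       ≡⟨ +-comm (w / m) 1 ⟩
      suc (w / m)     ∎
      where open ≤-Reasoning
    lemma : ∀ w j m t → w + j + suc t * m ≡ w + t * m + (j + m)
    lemma = solve-∀

-- Blocks of cold positions and their order

module Blocks (m δ h r : ℕ) .{{_ : NonZero m}} .{{_ : NonZero δ}} where

  open Stretch m

  -- The cold positions are the q k v with v < c. They form blocks, one for each k;
  -- block k is a * k + φ [r * k , r * k + c).
  b c a : ℕ
  b = m + δ
  c = h * m + r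
  a = b + 2 * (h * m)

  q : ℕ → ℕ → ℕ
  q k v = a * k + φ (r * k + v)

  m<b : m < b
  m<b = m<m+n m (>-nonZero⁻¹ δ)

  2m+δ≡b+m : 2 * m + δ ≡ b + m
  2m+δ≡b+m = lemma m δ
    where
    lemma : ∀ m δ → 2 * m + δ ≡ m + δ + m
    lemma = solve-∀

  q-+m : ∀ k v → q k (v + m) ≡ q k v + 2 * m
  q-+m k v = begin
    a * k + φ (r * k + (v + m))     ≡⟨ cong (λ t → a * k + φ t) (lemma (r * k) v m) ⟩
    a * k + φ (r * k + v + 1 * m)   ≡⟨ cong (a * k +_) (φ-+* (r * k + v) 1) ⟩
    a * k + (φ (r * k + v) + 2 * (1 * m)) ≡⟨ lemma′ (a * k) (φ (r * k + v)) m ⟩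
    q k v + 2 * m                   ∎
    where
    open ≡-Reasoning
    lemma : ∀ w v m → w + (v + m) ≡ w + v + 1 * m
    lemma = solve-∀
    lemma′ : ∀ x y m → x + (y + 2 * (1 * m)) ≡ x + y + 2 * m
    lemma′ = solve-∀

  -- Adding `c = h * m + r` advances `r * k` to `r * suc k` and leaves `h * m`, which φ doubles;
  -- with `b` this makes up `a`.
  q-+c : ∀ k v → q k (v + c) + b ≡ q (suc k) v
  q-+c k v = begin
    a * k + φ (r * k + (v + (h * m + r))) + b
      ≡⟨ cong (λ t → a * k + φ t + b) (lemma r k v (h * m)) ⟩
    a * k + φ (r * suc k + v + h * m) + b
      ≡⟨ cong (λ t → a * k + t + b) (φ-+* (r * suc k + v) h) ⟩
    a * k + (φ (r * suc k + v) + 2 * (h * m)) + b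
      ≡⟨ lemma′ b (2 * (h * m)) k (φ (r * suc k + v)) ⟩
    q (suc k) v ∎
    where
    open ≡-Reasoning
    lemma : ∀ r k v s → r * k + (v + (s + r)) ≡ r * suc k + v + s
    lemma = solve-∀
    lemma′ : ∀ b s k y → (b + s) * k + (y + s) + b ≡ (b + s) * suc k + y
    lemma′ = solve-∀

  q-mono-≤ : ∀ k {v v′} → v ≤ v′ → q k v ≤ q k v′
  q-mono-≤ k v≤v′ = +-monoʳ-≤ (a * k) (φ-mono-≤ (+-monoʳ-≤ (r * k) v≤v′))

  q-mono-< : ∀ k {v v′} → v < v′ → q k v < q k v′
  q-mono-< k v<v′ = +-monoʳ-< (a * k) (φ-mono-< (+-monoʳ-< (r * k) v<v′))

  q-suc : ∀ k v → q k (suc v) ≤ q k v + suc m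
  q-suc k v = begin
    a * k + φ (r * k + suc v)         ≡⟨ cong (λ t → a * k + φ t) (+-suc (r * k) v) ⟩
    a * k + φ (suc (r * k + v))       ≤⟨ +-monoʳ-≤ (a * k) (φ-suc (r * k + v)) ⟩
    a * k + (φ (r * k + v) + suc m)   ≡⟨ +-assoc (a * k) _ _ ⟨
    q k v + suc m                     ∎
    where open ≤-Reasoning

  q-≢+m : ∀ k v v′ → q k v′ ≢ q k v + m
  q-≢+m k v v′ eq = φ-≢+m (r * k + v) (r * k + v′)
    (+-cancelˡ-≡ (a * k) _ _ (trans eq (+-assoc (a * k) _ m)))

  q₀ : ∀ {v} → v < m → q 0 v ≡ v
  q₀ {v} v<m = begin
    a * 0 + φ (r * 0 + v) ≡⟨ cong₂ (λ s t → s + φ (t + v)) (*-zeroʳ a) (*-zeroʳ r) ⟩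
    φ v                   ≡⟨ φ-small v<m ⟩
    v                     ∎
    where open ≡-Reasoning

  -- By `q-+c` the right side is `b` above `q` of the preceding index at `v′ + c`, and
  -- `v < c ≤ v′ + c`. The bound `v′ < c` is not imposed, so that the recursion can continue with
  -- `v′ + c`.
  q-next : ∀ {k k′ v} v′ → k < k′ → v < c → q k v + b < q k′ v′
  q-next {k} {suc k′} {v} v′ k<k′ v<c =
    subst (q k v + b <_) (q-+c k′ v′) (+-monoˡ-< b (earlier (m<1+n⇒m<n∨m≡n k<k′)))
    where
    earlier : k < k′ ⊎ k ≡ k′ → q k v < q k′ (v′ + c)
    earlier (inj₂ refl) = q-mono-< k (<-≤-trans v<c (m≤n+m c v′))
    earlier (inj₁ k<k″) = ≤-<-trans (m≤m+n (q k v) b) (q-next (v′ + c) k<k″ v<c)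

  q-<-+ : ∀ {k k′ v v′ s} → k < k′ → v < c → q k v < q k′ v′ + s
  q-<-+ {v′ = v′} {s} k<k′ v<c = ≤-<-trans (m≤m+n _ b) (<-≤-trans (q-next v′ k<k′ v<c) (m≤m+n _ s))

  q-after-next : ∀ {k k′ v} v′ → suc k < k′ → v < c → q k v + (b + m) < q k′ v′
  q-after-next {k} {suc k′} {v} v′ k+1<k′ v<c = begin-strict
    q k v + (b + m)     ≡⟨ +-assoc (q k v) b m ⟨
    q k v + b + m       <⟨ +-mono-< (q-next (v′ + c) (s<s⁻¹ k+1<k′) v<c) m<b ⟩
    q k′ (v′ + c) + b   ≡⟨ q-+c k′ v′ ⟩
    q (suc k′) v′       ∎
    where open ≤-Reasoning

  Cold : ℕ → Set
  Cold x = ∃[ k ] ∃[ v ] v < c × x ≡ q k v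

  -- This gap is what distinguishes block starts from the other cold positions when periods are
  -- analysed.
  isolated : ∀ {k z} → Cold z → z < q k 0 → z + b < q k 0
  isolated {k} (j , v , v<c , refl) z<q with <-cmp j k
  ... | tri< j<k _ _  = q-next 0 j<k v<c
  ... | tri≈ _ refl _ = contradiction (q-mono-≤ j z≤n) (<⇒≱ z<q)
  ... | tri> _ _ k<j  = contradiction z<q
      (<-asym (≤-<-trans (m≤m+n (q k 0) b) (q-next v k<j (≤-<-trans z≤n v<c))))

  -- x or one of its options is cold, with v recorded so that the step from x to x + m
  -- can be followed.
  data Tile (x : ℕ) : Set where
    cold    : ∀ k v → v < c → x ≡ q k v → Tile x
    cold+m  : ∀ k v → v < c → x ≡ q k v + m → Tile x
    cold+b  : ∀ k v → v < c → x ≡ q k v + b → Tile x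
    cold+bm : ∀ k v → v < c → x ≡ q k v + (b + m) → Tile x

  -- The cold positions as a kernel

  module Tiling (m≤c : m ≤ c)
    (block-end : ∀ k {u} → u < m →
       ∃[ v ] v < c × (q k (u + c) ≡ q k v + b ⊎ q k (u + c) ≡ q k v + (b + m)))
    (block-apart : ∀ k v {v′} → v′ < c → q k v′ ≢ q k v + b × q k v′ ≢ q k v + (b + m))
    where

    private
      overflow : ∀ {v} → v < c → ¬ v + m < c → ∃[ u ] u < m × v + m ≡ u + c
      overflow {v} v<c v+m≮c with m≤n⇒∃[o]m+o≡n (≮⇒≥ v+m≮c)
      ... | u , c+u≡v+m = u , +-cancelˡ-< c u m (subst (_< c + m) (sym c+u≡v+m) (+-monoˡ-< m v<c))
                        , trans (sym c+u≡v+m) (+-comm c u)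

      next-m : ∀ k v → q k v + m + m ≡ q k (v + m)
      next-m k v = trans (lemma (q k v) m) (sym (q-+m k v))
        where
        lemma : ∀ x m → x + m + m ≡ x + 2 * m
        lemma = solve-∀

      next-bm : ∀ k v → q k v + (b + m) + m ≡ q k (v + m) + b
      next-bm k v = trans (lemma (q k v) b m) (cong (_+ b) (next-m k v))
        where
        lemma : ∀ x b m → x + (b + m) + m ≡ x + m + m + b
        lemma = solve-∀

    tile-+m : ∀ {x} → Tile x → Tile (x + m)
    tile-+m (cold k v v<c refl) = cold+m k v v<c refl
    tile-+m (cold+b k v v<c refl) = cold+bm k v v<c (+-assoc (q k v) b m)
    tile-+m (cold+m k v v<c refl) with v + m <? c
    ... | yes v+m<c = cold k (v + m) v+m<c (next-m k v)
    ... | no v+m≮c with overflow v<c v+m≮c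
    ...   | u , u<m , v+m≡u+c with block-end k u<m
    ...     | v′ , v′<c , inj₁ eq = cold+b k v′ v′<c (trans (next-m k v) (trans (cong (q k) v+m≡u+c) eq))
    ...     | v′ , v′<c , inj₂ eq = cold+bm k v′ v′<c (trans (next-m k v) (trans (cong (q k) v+m≡u+c) eq))
    tile-+m (cold+bm k v v<c refl) with v + m <? c
    ... | yes v+m<c = cold+b k (v + m) v+m<c (next-bm k v)
    ... | no v+m≮c with overflow v<c v+m≮c
    ...   | u , u<m , v+m≡u+c = cold (suc k) u (<-≤-trans u<m m≤c)
              (trans (next-bm k v) (trans (cong (λ t → q k t + b) v+m≡u+c) (q-+c k u)))

    tile-+* : ∀ {x} i → Tile x → Tile (x + i * m)
    tile-+* {x} zero    t = subst Tile (sym (+-identityʳ x)) t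
    tile-+* {x} (suc i) t = subst Tile (+-assoc x m (i * m)) (tile-+* i (tile-+m t))

    -- The residue `x % m` is itself cold, in block 0, and `x / m` steps of length `m` lead from it
    -- to `x`.
    tile : ∀ x → Tile x
    tile x = subst Tile (sym (m≡m%n+[m/n]*n x m))
      (tile-+* (x / m) (cold 0 (x % m) (<-≤-trans x%m<m m≤c) (sym (q₀ x%m<m))))
      where x%m<m = m%n<n x m

    S : SubtractionSet
    S = additiveSet m δ

    open SubtractionSet S using (elements)

    absorbing : ∀ x → Cold x ⊎ ∃[ y ] ∃[ s ] s ∈ elements × x ≡ y + s × Cold y
    absorbing x with tile x
    ... | cold k v v<c eq    = inj₁ (k , v , v<c , eq)
    ... | cold+m k v v<c eq  = inj₂ (q k v , m , here refl , eq , k , v , v<c , refl)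
    ... | cold+b k v v<c eq  = inj₂ (q k v , b , there (here refl) , eq , k , v , v<c , refl)
    ... | cold+bm k v v<c eq = inj₂ (q k v , 2 * m + δ , there (there (here refl))
                               , trans eq (cong (q k v +_) (sym 2m+δ≡b+m)) , k , v , v<c , refl)

    cold-≢+m : ∀ {y} → Cold y → ¬ Cold (y + m)
    cold-≢+m (k , v , v<c , refl) (k′ , v′ , v′<c , eq) with <-cmp k k′
    ... | tri< k<k′ _ _ = <⇒≢ (<-trans (+-monoʳ-< (q k v) m<b) (q-next v′ k<k′ v<c)) eq
    ... | tri≈ _ refl _ = q-≢+m k v v′ (sym eq)
    ... | tri> _ _ k′<k = <⇒≢ (q-<-+ k′<k v′<c) (sym eq)

    cold-≢+b : ∀ {y} → Cold y → ¬ Cold (y + b)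
    cold-≢+b (k , v , v<c , refl) (k′ , v′ , v′<c , eq) with <-cmp k k′
    ... | tri< k<k′ _ _ = <⇒≢ (q-next v′ k<k′ v<c) eq
    ... | tri≈ _ refl _ = proj₁ (block-apart k v v′<c) (sym eq)
    ... | tri> _ _ k′<k = <⇒≢ (q-<-+ k′<k v′<c) (sym eq)

    cold-≢+bm : ∀ {y} → Cold y → ¬ Cold (y + (b + m))
    cold-≢+bm (k , v , v<c , refl) (k′ , v′ , v′<c , eq) with <-cmp k k′
    ... | tri≈ _ refl _ = proj₂ (block-apart k v v′<c) (sym eq)
    ... | tri> _ _ k′<k = <⇒≢ (q-<-+ k′<k v′<c) (sym eq)
    ... | tri< k<k′ _ _ with m≤n⇒m<n∨m≡n k<k′
    ...   | inj₁ k+1<k′ = <⇒≢ (q-after-next v′ k+1<k′ v<c) eq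
    -- For adjacent blocks, `q-+c` pulls the later value back to index `k`; cancelling `b` leaves
    -- two values of `q k` that differ by `m`.
    ...   | inj₂ refl = q-≢+m k v (v′ + c) (+-cancelʳ-≡ b _ _ (begin
        q k (v′ + c) + b ≡⟨ q-+c k v′ ⟩
        q (suc k) v′     ≡⟨ eq ⟨
        q k v + (b + m)  ≡⟨ cong (q k v +_) (+-comm b m) ⟩
        q k v + (m + b)  ≡⟨ +-assoc (q k v) m b ⟨
        q k v + m + b    ∎))
      where open ≡-Reasoning

    independent : ∀ {y s} → s ∈ elements → Cold y → ¬ Cold (y + s)
    independent (here refl) = cold-≢+m
    independent (there (here refl)) = cold-≢+b
    independent {y} (there (there (here refl))) cy = cold-≢+bm cy ∘ subst (λ t → Cold (y + t)) 2m+δ≡b+m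

    open WallSubtraction S using (outcome)
    open Kernel S Cold independent absorbing

    -- Periods of the kernel

    B : ℕ
    B = a + 2 * r

    instance
      B≢0 : NonZero B
      B≢0 = >-nonZero (<-≤-trans (<-trans (>-nonZero⁻¹ m) m<b)
              (≤-trans (m≤m+n b (2 * (h * m))) (m≤m+n a (2 * r))))

    -- Since `r * n` is a multiple of `m`, φ turns this translation into one by `2 * (r * n)`;
    -- together with `a * n` this is `B * n`.
    q-shift : ∀ {n} → m ∣ r * n → ∀ k v → q (n + k) v ≡ q k v + B * n
    q-shift {n} (divides e rn≡em) k v = begin
      a * (n + k) + φ (r * (n + k) + v)
        ≡⟨ cong (λ t → a * (n + k) + φ t) (trans (lemma r n k v) (cong (r * k + v +_) rn≡em)) ⟩
      a * (n + k) + φ (r * k + v + e * m)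
        ≡⟨ cong (a * (n + k) +_) (φ-+* (r * k + v) e) ⟩
      a * (n + k) + (φ (r * k + v) + 2 * (e * m))
        ≡⟨ cong (λ t → a * (n + k) + (φ (r * k + v) + 2 * t)) rn≡em ⟨
      a * (n + k) + (φ (r * k + v) + 2 * (r * n))
        ≡⟨ lemma′ a n k (φ (r * k + v)) r ⟩
      q k v + B * n ∎
      where
      open ≡-Reasoning
      lemma : ∀ r n k v → r * (n + k) + v ≡ r * k + v + r * n
      lemma = solve-∀
      lemma′ : ∀ a n k y r → a * (n + k) + (y + 2 * (r * n)) ≡ a * k + y + (a + 2 * r) * n
      lemma′ = solve-∀

    q-start : ∀ {n} → m ∣ r * n → q n 0 ≡ B * n
    q-start {n} m∣rn = begin
      q n 0           ≡⟨ cong (λ t → q t 0) (+-identityʳ n) ⟨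
      q (n + 0) 0     ≡⟨ q-shift m∣rn 0 0 ⟩
      q 0 0 + B * n   ≡⟨ cong (_+ B * n) (q₀ (>-nonZero⁻¹ m)) ⟩
      B * n           ∎
      where open ≡-Reasoning

    cold-period : ∀ {n} → m ∣ r * n → ∀ x → outcome (x + B * n) ≡ outcome x
    cold-period {n} m∣rn x = outcome-cong back forth
      where
      forth : Cold x → Cold (x + B * n)
      forth (k , v , v<c , refl) = n + k , v , v<c , sym (q-shift m∣rn k v)

      -- A position from `B * n = q n 0` on cannot lie in a block before block `n`, so `q-shift` can
      -- be undone.
      back : Cold (x + B * n) → Cold x
      back (k , v , v<c , eq) with k <? n
      ... | yes k<n = contradiction eq (<⇒≢ (begin-strict
            q k v       ≤⟨ m≤m+n (q k v) b ⟩
            q k v + b   <⟨ q-next 0 k<n v<c ⟩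
            q n 0       ≡⟨ q-start m∣rn ⟩
            B * n       ≤⟨ m≤n+m (B * n) x ⟩
            x + B * n   ∎) ∘ sym)
        where open ≤-Reasoning
      ... | no k≮n with m≤n⇒∃[o]m+o≡n (≮⇒≥ k≮n)
      ...   | k′ , refl = k′ , v , v<c , +-cancelʳ-≡ (B * n) _ _ (trans eq (q-shift m∣rn k′ v))

    -- Position 0 is cold, so its translate `t` is cold. Then `inside` forces `t` to start a block,
    -- and `unbroken` gives the divisibility.
    period-form : ∀ {n} → .{{NonZero n}} → m ∣ r * n → ∀ {t} → t ≥ 1 → IsEventualPeriod outcome t →
                  ∃[ l ] l ≥ 1 × m ∣ r * l × t ≡ B * l
    period-form {n} m∣rn {t} t≥1 per = start (pure {0} (cold₀ (>-nonZero⁻¹ m)))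
      where
      pure : ∀ {x} → Cold x → Cold (x + t)
      pure {x} = kernel-cong (sym (eventual⇒pure (cold-period m∣rn) {{m*n≢0 B n}} per x))

      unpure : ∀ {x} → Cold (x + t) → Cold x
      unpure {x} = kernel-cong (eventual⇒pure (cold-period m∣rn) {{m*n≢0 B n}} per x)

      cold₀ : ∀ {x} → x < m → Cold x
      cold₀ x<m = 0 , _ , <-≤-trans x<m m≤c , sym (q₀ x<m)

      -- q l v lies j ≤ b below t. Moved up by B * n and down by t, it would be a cold
      -- position j below the start q n 0 of a block.
      inside : ∀ {l v} → suc v < c → t ≢ q l (suc v)
      inside {l} {v} v+1<c t≡ with m≤n⇒∃[o]m+o≡n (<⇒≤ (q-mono-< l (n<1+n v)))
      ... | zero  , q≡ = <⇒≢ (q-mono-< l (n<1+n v)) (trans (sym (+-identityʳ _)) q≡)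
      ... | suc j , q≡ = <⇒≱ (isolated (unpure cold-z+t) (subst (z <_) z+j≡q (m<m+n z z<s)))
                           (subst (_≤ z + b) z+j≡q (+-monoʳ-≤ z j≤b))
        where
        open ≡-Reasoning
        z = B * n ∸ suc j
        -- Consecutive values of `q l` differ by at most `m + 1`, and `m < b`.
        j≤b : suc j ≤ b
        j≤b = ≤-trans (+-cancelˡ-≤ (q l v) _ _ (≤-trans (≤-reflexive q≡) (q-suc l v))) m<b
        z+j≡p : z + suc j ≡ B * n
        z+j≡p = m∸n+n≡m (≤-trans j≤b (≤-trans (m≤m+n b (2 * (h * m)))
                  (≤-trans (m≤m+n a (2 * r)) (m≤m*n B n))))
        z+j≡q : z + suc j ≡ q n 0
        z+j≡q = trans z+j≡p (sym (q-start m∣rn))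
        cold-z+t : Cold (z + t)
        cold-z+t = n + l , v , <-trans (n<1+n v) v+1<c , (begin
          z + t                 ≡⟨ cong (z +_) (trans t≡ (sym q≡)) ⟩
          z + (q l v + suc j)   ≡⟨ x∙yz≈y∙xz z (q l v) (suc j) ⟩
          q l v + (z + suc j)   ≡⟨ cong (q l v +_) z+j≡p ⟩
          q l v + B * n         ≡⟨ q-shift m∣rn l v ⟨
          q (n + l) v           ∎)

      -- Otherwise φ jumps by m somewhere on [r * l , r * l + m), and pred m + t is
      -- m above the value of φ just before r * l.
      unbroken : ∀ {l} → t ≡ q l 0 → m ∣ r * l
      unbroken {l} t≡ with (r * l) % m in rl%m≡
      ... | zero  = m%n≡0⇒n∣m (r * l) m rl%m≡
      ... | suc ρ = contradiction (pure (cold₀ (≤-reflexive (suc-pred m)))) broken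
        where
        e = r * l / m
        -- The predecessor of `r * l`. As the remainder `suc ρ` is positive, both have the same
        -- quotient by `m`, and φ does not jump between them.
        w = ρ + e * m
        rl≡ : r * l + 0 ≡ suc w
        rl≡ = trans (+-identityʳ (r * l)) (trans (m≡m%n+[m/n]*n (r * l) m) (cong (_+ e * m) rl%m≡))
        ρ+1<m : suc ρ < m
        ρ+1<m = subst (_< m) rl%m≡ (m%n<n (r * l) m)
        w/m≡ : suc w / m ≡ w / m
        w/m≡ = begin
          suc w / m      ≡⟨ quotient-+ (suc ρ) e ⟩
          suc ρ / m + e  ≡⟨ cong (_+ e) (m<n⇒m/n≡0 ρ+1<m) ⟩
          e              ≡⟨ cong (_+ e) (m<n⇒m/n≡0 (<-trans (n<1+n ρ) ρ+1<m)) ⟨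
          ρ / m + e      ≡⟨ quotient-+ ρ e ⟨
          w / m          ∎
          where open ≡-Reasoning
        ql≡ : q l 0 ≡ a * l + suc (φ w)
        ql≡ = cong (a * l +_) (trans (cong φ rl≡) (φ-suc-≡ w/m≡))
        broken : ¬ Cold (pred m + t)
        broken (k , v , v<c , eq) with <-cmp k l
        ... | tri< k<l _ _ = <⇒≢ (begin-strict
            q k v         ≤⟨ m≤m+n (q k v) b ⟩
            q k v + b     <⟨ q-next 0 k<l v<c ⟩
            q l 0         ≡⟨ t≡ ⟨
            t             ≤⟨ m≤n+m t (pred m) ⟩
            pred m + t    ∎) (sym eq)
          where open ≤-Reasoning
        -- φ does not shrink distances, so `pred m + t` is at most `q l (pred m)`, which precedes
        -- every later block.
        ... | tri> _ _ l<k = <⇒≢ (begin-strict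
            pred m + t            ≡⟨ cong (pred m +_) t≡ ⟩
            pred m + q l 0        ≡⟨ x∙yz≈y∙zx (pred m) (a * l) (φ (r * l + 0)) ⟩
            a * l + (φ (r * l + 0) + pred m) ≤⟨ +-monoʳ-≤ (a * l) (φ-expand (r * l + 0) (pred m)) ⟩
            a * l + φ (r * l + 0 + pred m) ≡⟨ cong (λ s → a * l + φ (s + pred m)) (+-identityʳ (r * l)) ⟩
            q l (pred m)          ≤⟨ m≤m+n _ b ⟩
            q l (pred m) + b      <⟨ q-next v l<k (<-≤-trans (≤-reflexive (suc-pred m)) m≤c) ⟩
            q k v                 ∎) eq
          where open ≤-Reasoning
        ... | tri≈ _ refl _ = φ-≢+m w (r * l + v) (+-cancelˡ-≡ (a * l) _ _ (begin
            q l v                               ≡⟨ eq ⟨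
            pred m + t                          ≡⟨ cong (pred m +_) (trans t≡ ql≡) ⟩
            pred m + (a * l + suc (φ w))        ≡⟨ lemma (pred m) (a * l) (φ w) ⟩
            a * l + (φ w + suc (pred m))        ≡⟨ cong (λ s → a * l + (φ w + s)) (suc-pred m) ⟩
            a * l + (φ w + m)                   ∎))
          where
          open ≡-Reasoning
          lemma : ∀ x y z → x + (y + suc z) ≡ y + (z + suc x)
          lemma = solve-∀

      start : Cold t → ∃[ l ] l ≥ 1 × m ∣ r * l × t ≡ B * l
      start (l     , suc v , v+1<c , t≡) = contradiction t≡ (inside v+1<c)
      start (zero  , zero  , _     , t≡) = contradiction (trans t≡ (q₀ (>-nonZero⁻¹ m))) (>⇒≢ t≥1)
      start (suc l , zero  , _     , t≡) = suc l , s≤s z≤n , m∣rl , trans t≡ (q-start m∣rl)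
        where m∣rl = unbroken t≡

    period-length : ∀ {n} → .{{NonZero n}} → m ∣ r * n →
                    (∀ {l} → l ≥ 1 → m ∣ r * l → n ≤ l) → IsPeriodLength outcome (B * n)
    period-length {n} m∣rn least =
        >-nonZero⁻¹ (B * n) {{m*n≢0 B n}} , (0 , λ x _ → cold-period m∣rn x) , minimal
      where
      minimal : ∀ t → t ≥ 1 → IsEventualPeriod outcome t → B * n ≤ t
      minimal t t≥1 per with period-form m∣rn t≥1 per
      ... | l , l≥1 , m∣rl , refl = *-monoʳ-≤ B (least l≥1 m∣rl)

-- The case d ≤ m, with r = 0

module SmallResidue (m δ h d : ℕ) .{{_ : NonZero m}} .{{_ : NonZero δ}} .{{_ : NonZero h}}
  (d≤m : d ≤ m) (b+m≡ : m + δ + m ≡ 2 * (h * m) + d) where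

  open Stretch m
  open Blocks m δ h 0

  private
    c≡hm : c ≡ h * m
    c≡hm = +-identityʳ (h * m)

    m≤hm : m ≤ h * m
    m≤hm = m≤n*m m h

    -- Here `2 * (h * m) = b + m - d`. Hence the witness is `u - d`, with translate `b + m`, when
    -- `d ≤ u`, and `u + m - d`, with translate `b`, otherwise.
    block-end : ∀ k {u} → u < m →
      ∃[ v ] v < c × (q k (u + c) ≡ q k v + b ⊎ q k (u + c) ≡ q k v + (b + m))
    block-end k {u} u<m with d ≤? u
    ... | yes d≤u with m≤n⇒∃[o]m+o≡n d≤u
    ...   | v , refl = v , ≤-trans v<m m≤c , inj₂ (begin
        a * k + φ (d + v + c)               ≡⟨ cong (λ t → a * k + φ (d + v + t)) c≡hm ⟩
        a * k + φ (d + v + h * m)           ≡⟨ cong (a * k +_) (φ-+* (d + v) h) ⟩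
        a * k + (φ (d + v) + 2 * (h * m))   ≡⟨ cong (λ t → a * k + (t + 2 * (h * m))) (φ-small u<m) ⟩
        a * k + (d + v + 2 * (h * m))       ≡⟨ lemma (a * k) d v (2 * (h * m)) ⟩
        a * k + v + (2 * (h * m) + d)       ≡⟨ cong₂ (λ s t → a * k + s + t) (φ-small v<m) b+m≡ ⟨
        q k v + (b + m)                     ∎)
      where
      open ≡-Reasoning
      v<m : v < m
      v<m = ≤-<-trans (m≤n+m v d) u<m
      m≤c : m ≤ c
      m≤c = subst (m ≤_) (sym c≡hm) m≤hm
      lemma : ∀ x d v y → x + (d + v + y) ≡ x + v + (y + d)
      lemma = solve-∀
    block-end k {u} u<m | no d≰u with m≤n⇒∃[o]m+o≡n (≤-trans d≤m (m≤n+m m u))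
    ... | v , d+v≡u+m = v , <-≤-trans v<m (subst (m ≤_) (sym c≡hm) m≤hm) , inj₁ (begin
        a * k + φ (u + c)               ≡⟨ cong (λ t → a * k + φ (u + t)) c≡hm ⟩
        a * k + φ (u + h * m)           ≡⟨ cong (a * k +_) (φ-+* u h) ⟩
        a * k + (φ u + 2 * (h * m))     ≡⟨ cong (λ t → a * k + (t + 2 * (h * m))) (φ-small u<m) ⟩
        a * k + (u + 2 * (h * m))       ≡⟨ cong (a * k +_) u+2hm≡v+b ⟩
        a * k + (v + b)                 ≡⟨ +-assoc (a * k) v b ⟨
        a * k + v + b                   ≡⟨ cong (λ t → a * k + t + b) (φ-small v<m) ⟨
        q k v + b                       ∎)
      where
      open ≡-Reasoning
      v<m : v < m
      v<m = +-cancelˡ-< d v m (subst (_< d + m) (sym d+v≡u+m) (+-monoˡ-< m (≰⇒> d≰u)))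
      u+2hm≡v+b : u + 2 * (h * m) ≡ v + b
      u+2hm≡v+b = +-cancelʳ-≡ (d + m) _ _ (begin
        u + 2 * (h * m) + (d + m)   ≡⟨ lemma u (2 * (h * m)) d m ⟩
        u + m + (2 * (h * m) + d)   ≡⟨ cong₂ _+_ d+v≡u+m b+m≡ ⟨
        d + v + (b + m)             ≡⟨ lemma′ d v b m ⟩
        v + b + (d + m)             ∎)
        where
        lemma : ∀ u x d m → u + x + (d + m) ≡ u + m + (x + d)
        lemma = solve-∀
        lemma′ : ∀ d v b m → d + v + (b + m) ≡ v + b + (d + m)
        lemma′ = solve-∀

    -- Below `h * m` the values of φ stay below `2 * (h * m) - m = b - d`, so a whole block is
    -- shorter than `b`.
    block-short : ∀ k v {v′} → v′ < c → q k v′ < q k v + b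
    block-short k v {v′} v′<c = begin-strict
      a * k + φ v′    <⟨ +-monoʳ-< (a * k) φv′<b ⟩
      a * k + b       ≤⟨ +-monoˡ-≤ b (m≤m+n (a * k) (φ v)) ⟩
      q k v + b       ∎
      where
      open ≤-Reasoning
      v′<hm : v′ < h * m
      v′<hm = subst (v′ <_) c≡hm v′<c
      φv′<b : φ v′ < b
      φv′<b = +-cancelʳ-< m (φ v′) b (begin-strict
        v′ + v′ / m * m + m     ≡⟨ lemma v′ (v′ / m) m ⟩
        v′ + suc (v′ / m) * m   <⟨ +-mono-<-≤ v′<hm (*-monoˡ-≤ m (m<n*o⇒m/o<n {n = h} v′<hm)) ⟩
        h * m + h * m           ≡⟨ cong (h * m +_) (+-identityʳ (h * m)) ⟨
        2 * (h * m)             ≤⟨ m≤m+n (2 * (h * m)) d ⟩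
        2 * (h * m) + d         ≡⟨ b+m≡ ⟨
        b + m                   ∎)
        where
        lemma : ∀ x t m → x + t * m + m ≡ x + suc t * m
        lemma = solve-∀

    block-apart : ∀ k v {v′} → v′ < c → q k v′ ≢ q k v + b × q k v′ ≢ q k v + (b + m)
    block-apart k v v′<c = <⇒≢ (block-short k v v′<c)
                         , <⇒≢ (<-≤-trans (block-short k v v′<c) (+-monoʳ-≤ (q k v) (m≤m+n b m)))

  open Tiling (subst (m ≤_) (sym c≡hm) m≤hm) block-end block-apart

  periodLength : IsPeriodLength (WallSubtraction.outcome (additiveSet m δ)) (m + δ + 2 * (h * m))
  periodLength = subst (IsPeriodLength _) (trans (*-identityʳ B) (+-identityʳ a))
    -- With `r = 0` the divisibility already holds for `n = 1`.
    (period-length (m ∣0) (λ l≥1 _ → l≥1))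

-- The case d = m + r > m

module LargeResidue (m δ h r : ℕ) .{{_ : NonZero m}} .{{_ : NonZero δ}} .{{_ : NonZero h}}
  (r<m : r < m) (b≡ : m + δ ≡ 2 * (h * m) + r) where

  open Stretch m
  open Blocks m δ h r

  private
    q-+c-expand : ∀ k u → q k (u + c) ≡ a * k + (φ (r * k + u + r) + 2 * (h * m))
    q-+c-expand k u = cong (a * k +_) (trans (cong φ (lemma (r * k) u (h * m) r)) (φ-+* (r * k + u + r) h))
      where
      lemma : ∀ w u s r → w + (u + (s + r)) ≡ w + u + r + s
      lemma = solve-∀

    -- Beyond the stretched `h * m` there remains a step of `r < m`, which φ lengthens to `r` or
    -- `r + m`; and `b = 2 * (h * m) + r`.
    q-+c-same : ∀ k u → q k (u + c) ≡ q k u + b ⊎ q k (u + c) ≡ q k u + (b + m)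
    q-+c-same k u with φ-+ (r * k + u) (<⇒≤ r<m)
    ... | inj₁ eq = inj₁ (begin
        q k (u + c)                                     ≡⟨ q-+c-expand k u ⟩
        a * k + (φ (r * k + u + r) + 2 * (h * m))       ≡⟨ cong (λ t → a * k + (t + 2 * (h * m))) eq ⟩
        a * k + (φ (r * k + u) + r + 2 * (h * m))       ≡⟨ lemma (a * k) (φ (r * k + u)) r (2 * (h * m)) ⟩
        q k u + (2 * (h * m) + r)                       ≡⟨ cong (q k u +_) b≡ ⟨
        q k u + b                                       ∎)
      where
      open ≡-Reasoning
      lemma : ∀ x y r s → x + (y + r + s) ≡ x + y + (s + r)
      lemma = solve-∀
    ... | inj₂ eq = inj₂ (begin
        q k (u + c)                                     ≡⟨ q-+c-expand k u ⟩
        a * k + (φ (r * k + u + r) + 2 * (h * m))       ≡⟨ cong (λ t → a * k + (t + 2 * (h * m))) eq ⟩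
        a * k + (φ (r * k + u) + (r + m) + 2 * (h * m)) ≡⟨ lemma (a * k) (φ (r * k + u)) r m (2 * (h * m)) ⟩
        q k u + (2 * (h * m) + r + m)                   ≡⟨ cong (λ t → q k u + (t + m)) b≡ ⟨
        q k u + (b + m)                                 ∎)
      where
      open ≡-Reasoning
      lemma : ∀ x y r m s → x + (y + (r + m) + s) ≡ x + y + (s + r + m)
      lemma = solve-∀

    m≤c : m ≤ c
    m≤c = ≤-trans (m≤n*m m h) (m≤m+n (h * m) r)

    block-end : ∀ k {u} → u < m →
      ∃[ v ] v < c × (q k (u + c) ≡ q k v + b ⊎ q k (u + c) ≡ q k v + (b + m))
    block-end k {u} u<m = u , <-≤-trans u<m m≤c , q-+c-same k u

    -- Each of q k v + b and q k v + (b + m) is q k (v + c) or differs from it by m.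
    block-apart : ∀ k v {v′} → v′ < c → q k v′ ≢ q k v + b × q k v′ ≢ q k v + (b + m)
    block-apart k v {v′} v′<c with q-+c-same k v
    ... | inj₁ eq = (λ eq′ → <⇒≢ short (trans eq′ (sym eq)))
                  , (λ eq′ → q-≢+m k (v + c) v′ (trans eq′
                      (trans (sym (+-assoc (q k v) b m)) (cong (_+ m) (sym eq)))))
      where short = q-mono-< k (<-≤-trans v′<c (m≤n+m c v))
    ... | inj₂ eq = (λ eq′ → q-≢+m k v′ (v + c) (trans eq
                      (trans (sym (+-assoc (q k v) b m)) (cong (_+ m) (sym eq′)))))
                  , (λ eq′ → <⇒≢ short (trans eq′ (sym eq)))
      where short = q-mono-< k (<-≤-trans v′<c (m≤n+m c v))

  open Tiling m≤c block-end block-apart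

  periodLength : .{{_ : NonZero (gcd m (m + r))}} →
    IsPeriodLength (WallSubtraction.outcome (additiveSet m δ)) (m * (m + 2 * δ + (m + r)) / gcd m (m + r))
  periodLength = subst (IsPeriodLength _) B*n≡
    (period-length {m / g} {{≢-nonZero (m/gcd[m,n]≢0 m (m + r))}} m∣rn least)
    where
    g = gcd m (m + r)

    g∣m : g ∣ m
    g∣m = gcd[m,n]∣m m (m + r)

    B≡ : B ≡ m + 2 * δ + (m + r)
    B≡ = begin
      m + δ + 2 * (h * m) + 2 * r     ≡⟨ lemma m δ (2 * (h * m)) r ⟩
      m + δ + r + (2 * (h * m) + r)   ≡⟨ cong (m + δ + r +_) b≡ ⟨
      m + δ + r + (m + δ)             ≡⟨ lemma′ m δ r ⟩
      m + 2 * δ + (m + r)             ∎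
      where
      open ≡-Reasoning
      lemma : ∀ m δ s r → m + δ + s + 2 * r ≡ m + δ + r + (s + r)
      lemma = solve-∀
      lemma′ : ∀ m δ r → m + δ + r + (m + δ) ≡ m + 2 * δ + (m + r)
      lemma′ = solve-∀

    B*n≡ : B * (m / g) ≡ m * (m + 2 * δ + (m + r)) / g
    B*n≡ = begin
      B * (m / g)     ≡⟨ *-/-assoc B g∣m ⟨
      B * m / g       ≡⟨ cong (_/ g) (trans (*-comm B m) (cong (m *_) B≡)) ⟩
      m * (m + 2 * δ + (m + r)) / g ∎
      where open ≡-Reasoning

    m∣rn : m ∣ r * (m / g)
    m∣rn with ∣m+n∣m⇒∣n (gcd[m,n]∣n m (m + r)) g∣m
    ... | divides e r≡eg = divides e (begin
        r * (m / g)        ≡⟨ cong (_* (m / g)) r≡eg ⟩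
        e * g * (m / g)    ≡⟨ *-assoc e g (m / g) ⟩
        e * (g * (m / g))  ≡⟨ cong (e *_) (m*[n/m]≡n g∣m) ⟩
        e * m              ∎)
      where open ≡-Reasoning

    -- `m` divides both `l * m` and `l * (m + r)`, hence their gcd `l * g`.
    least : ∀ {l} → l ≥ 1 → m ∣ r * l → m / g ≤ l
    least {l} l≥1 m∣rl = begin
      m / g       ≤⟨ /-monoˡ-≤ g (∣⇒≤ {{m*n≢0 l g {{>-nonZero l≥1}}}} m∣lg) ⟩
      l * g / g   ≡⟨ m*n/n≡m l g ⟩
      l           ∎
      where
      open ≤-Reasoning
      m∣l[m+r] : m ∣ l * (m + r)
      m∣l[m+r] = subst (m ∣_) (sym (*-distribˡ-+ l m r))
        (∣m∣n⇒∣m+n (n∣m*n l) (subst (m ∣_) (*-comm r l) m∣rl))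
      m∣lg : m ∣ l * g
      m∣lg = subst (m ∣_) (sym (c*gcd[m,n]≡gcd[cm,cn] l m (m + r)))
        (gcd-greatest (n∣m*n l) m∣l[m+r])

-- Choice of h and r from the residue of δ

corollary4 : (m δ : ℕ) .{{_ : NonZero m}} .{{_ : NonZero δ}} →
    IsPeriodLength (WallSubtraction.outcome (additiveSet m δ)) (additivePeriod m δ)
corollary4 m δ with (δ % (2 * m)) {{m*n≢0 2 m}} ≤? m
... | yes d≤m = subst (IsPeriodLength _) period≡
    -- The two copies of `m` in `b + m` add one `2 * m` to the `k` of them in `δ`, so `h = suc k`.
    (SmallResidue.periodLength m δ (suc k) d d≤m (trans (cong (λ t → m + t + m) δ≡) (lemma m d k)))
  where
  k d : ℕ
  k = (δ / (2 * m)) {{m*n≢0 2 m}}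
  d = (δ % (2 * m)) {{m*n≢0 2 m}}
  δ≡ : δ ≡ d + k * (2 * m)
  δ≡ = m≡m%n+[m/n]*n δ (2 * m) {{m*n≢0 2 m}}
  lemma : ∀ m d k → m + (d + k * (2 * m)) + m ≡ 2 * (suc k * m) + d
  lemma = solve-∀
  lemma′ : ∀ m d k δ → 3 * m + (δ + (d + k * (2 * m))) ≡ m + δ + 2 * (suc k * m) + d
  lemma′ = solve-∀
  period≡ : m + δ + 2 * (suc k * m) ≡ 3 * m + 2 * δ ∸ d
  period≡ = begin
    m + δ + 2 * (suc k * m)                 ≡⟨ m+n∸n≡m _ d ⟨
    m + δ + 2 * (suc k * m) + d ∸ d         ≡⟨ cong (_∸ d) (lemma′ m d k δ) ⟨
    3 * m + (δ + (d + k * (2 * m))) ∸ d     ≡⟨ cong (λ t → 3 * m + (δ + t) ∸ d) (trans (+-identityʳ δ) δ≡) ⟨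
    3 * m + 2 * δ ∸ d                       ∎
    where open ≡-Reasoning
... | no d≰m with m≤n⇒∃[o]m+o≡n (<⇒≤ (≰⇒> d≰m))
-- The motive abstracts the `NonZero` instance as well, since it depends on `d` through the gcd.
...   | r , m+r≡d = subst (λ d → .{{_ : NonZero (gcd m d)}} →
      IsPeriodLength (WallSubtraction.outcome (additiveSet m δ)) (m * (m + 2 * δ + d) / gcd m d)) m+r≡d
    -- The `m` in `b` and the `m` in `d = m + r` again supply one further `2 * m`.
    (LargeResidue.periodLength m δ (suc k) r r<m (trans (cong (m +_) δ≡) (lemma m r k)))
    {{≢-nonZero (gcd[m,n]≢0 m _ (inj₁ (≢-nonZero⁻¹ m)))}}
  where
  k : ℕ
  k = (δ / (2 * m)) {{m*n≢0 2 m}}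
  δ≡ : δ ≡ m + r + k * (2 * m)
  δ≡ = trans (m≡m%n+[m/n]*n δ (2 * m) {{m*n≢0 2 m}}) (cong (_+ k * (2 * m)) (sym m+r≡d))
  r<m : r < m
  r<m = +-cancelˡ-< m r m (subst₂ _<_ (sym m+r≡d) (cong (m +_) (+-identityʳ m)) (m%n<n δ (2 * m) {{m*n≢0 2 m}}))
  lemma : ∀ m r k → m + (m + r + k * (2 * m)) ≡ 2 * (suc k * m) + r
  lemma = solve-∀
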